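{- Let $\mathcal{T}=\{P_{\mathcal T},\Delta\}$ be a canonical theory with $\Delta$ a total definition, let $\mathcal{I}_{in}$ be an input structure, and let $\langle \Delta_g,\Delta_d,J,\mathcal{I}\rangle$ be an acceptable state of $\mathcal{T}$ with input structure $\mathcal{I}_{in}$ such that $P_{\mathcal T}$ is true in $\mathcal{I}$ and the restriction $\mathcal{I}|_{voc(\Delta_g)}$ is a model of $\Delta_g$. Then there exists a model $\mathcal{M}$ of $\mathcal{T}$ that expands $\mathcal{I}|_{voc(\Delta_g)}$.
   Context: **Structures.** A domain $D$ (possibly infinite) is fixed. Vocabularies are function-free (predicate symbols only, including the propositional symbols $\top,\bot$, which every structure interprets as true and false respectively). A domain atom is $P(\bar d)$ with $P/n$ a predicate symbol and $\bar d\in D^n$; a domain literal is a domain atom or its negation. A (four-valued) structure assigns to each domain atom a value in $\{\mathbf t,\mathbf f,\mathbf u,\mathbf i\}$ (true, false, unknown, inconsistent); equivalently it is a set $S$ of domain literals: $a$ is $\mathbf i$ if both $a,\neg a\in S$, $\mathbf t$ if only $a\in S$, $\mathbf f$ if only $\neg a\in S$, $\mathbf u$ otherwise. It is inconsistent if some atom is $\mathbf i$, and two-valued if all values are in $\{\mathbf t,\mathbf f\}$. A literal is true in $S$ if its value is $\mathbf t$, false if its value is $\mathbf f$. A structure of a vocabulary is also viewed as a structure of any larger vocabulary (new atoms $\mathbf u$). $\mathcal I'$ expands $\mathcal I$ ($\mathcal I'\ge_p\mathcal I$) iff $\mathcal I'\supseteq\mathcal I$ as sets of literals. For a set $\sigma$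 of predicate symbols (or of domain atoms), $\mathcal I|_\sigma$ is the restriction of $\mathcal I$ to $\sigma$ (unknown elsewhere). $voc(\cdot)$ is the set of predicate symbols occurring in its argument. Formulas are first-order with quantifiers bounded by explicit subsets $D'\subseteq D$; their four-valued truth value $\varphi^{\mathcal I}$ is defined inductively, with $\wedge,\forall$ as minimum and $\vee,\exists$ as maximum in the truth order ($\mathbf t>_t\mathbf u>_t\mathbf f$, $\mathbf t>_t\mathbf i>_t\mathbf f$), and $\neg$ swapping $\mathbf t,\mathbf f$ and fixing $\mathbf u,\mathbf i$. **Definitions.** A definition $\Delta$ is a finite set of rules $\forall\bar x\in\bar D: P(\bar x)\leftarrow\varphi$, $\varphi$ a first-order formula (in negation normal form) with free variables among $\bar x$. A domain atom $P(\bar d)$ (and the literal $\neg P(\bar d)$) is defined by $\Delta$ if some rule with head predicate $P$ has $\bar d\in\bar D$; otherwise it is open. Each domain atom is defined by at most one rule. $open(\Delta)$ is the set of open domain atoms. For a two-valued structure $\mathcal I_{open}$ of $open(\Delta)$, the (parametrized) well-founded model $wf_\Delta(\mathcal I_{open})$ is the limit of any maximal transfinite refinement process starting at $\mathcal I_{open}$ with all defined atoms unknown, where each step either makes true an unknown defined atom whose rule body instance is true in the current structure, or makes false all atoms of a set $U$ of unknown defined atoms such that, after setting $U$ to false, the body instances of all atoms in $U$ are false. A structure $\mathcal I$ is a model of $\Delta$ iff it is two-valued (on the symbols of $\Delta$) and equals $wf_\Delta(\mathcal I|_{open(\Delta)})$. $\Delta$ is total if $wf_\Delta(\mathcal I_{open})$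 is two-valued for every two-valued structure $\mathcal I_{open}$ of $open(\Delta)$. **Canonical theory.** $\mathcal T=\{P_{\mathcal T},\Delta\}$ with $P_{\mathcal T}$ a propositional symbol (a sentence), defined by $\Delta$, and $\Delta$ a total definition. A model of $\mathcal T$ is a model of $\Delta$ in which $P_{\mathcal T}$ is true. Two theories $T,T'$ are strongly $\Sigma$-equivalent if each model of $T$ restricted to $\Sigma$ can be expanded to a unique model of $T'$, and vice versa. **Justifications.** A direct justification over $\Delta$ for a defined literal $P(\bar d)$ (resp. $\neg P(\bar d)$), with rule $\forall\bar x\in\bar D:P(\bar x)\leftarrow\varphi$, $\bar d\in\bar D$, is a consistent non-empty set $S$ of domain literals with $\varphi[\bar x/\bar d]^S=\mathbf t$ (resp. $\mathbf f$). A justification over $\Delta$ is a directed graph $J$ on domain literals such that for each literal $l$ the set $J(l)$ of children of $l$ is empty or a direct justification of $l$; $J$ is defined in $l$ if $J(l)\ne\emptyset$. $J_l$ (resp. $J_L$) is the subgraph of nodes and edges reachable from $l$ (resp. from some $l\in L$). $J$ is total for $L$ if $J$ is defined in each literal that is defined in $\Delta$ and reachable from $L$. A path is negative if all its literals are negative. A defined literal $l$ is well-founded in $J$ if every infinite path in $J_l$ is negative. $J$ justifies a set $L$ of defined literals if $J_L$ is total for $L$, each literal of $L$ is well-founded in $J$, and the set of literals in $J_L$ is consistent. $J$ is consistent with a structure $\mathcal I$ if $\mathcal I$ is consistent and none of the literals occurring in $J$ is false in $\mathcal I$. **Acceptable state.** Write $\Delta_{gd}=\Delta_g\cup\Delta_d$.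 A tuple $\langle\Delta_g,\Delta_d,J,\mathcal I\rangle$ ($\Delta_g$ a set of ground rules, $\Delta_d$ a set of possibly non-ground rules) is an acceptable state of $\mathcal T=\{P_{\mathcal T},\Delta\}$ with input structure $\mathcal I_{in}$ if: (i) $\Delta_{gd},\Delta_g,\Delta_d$ are total definitions and $\Delta_{gd}$ is strongly $voc(\Delta)$-equivalent with $\Delta$; (ii) no domain atom is defined in both $\Delta_g$ and $\Delta_d$; (iii) $J$ is a justification over $\Delta_{gd}$; (iv) $\mathcal I$ is an expansion of $\mathcal I_{in}$; (v) the set $L$ of literals true in $\mathcal I$ and defined in $\Delta_d$ is justified by $J$; (vi) $J_L$ is consistent with $\mathcal I$. -}

module Defs where

open import Data.Empty using (⊥)
open import Data.Fin using (Fin)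
open import Data.List using (List; length; lookup; _++_)
open import Data.Nat using (ℕ; suc)
open import Data.Product using (Σ; ∃; _×_; _,_; proj₁; proj₂)
open import Data.Sum using (_⊎_; inj₁; inj₂)
open import Data.Unit using (⊤; tt)
open import Data.Vec as Vec using (Vec; []; _∷_)
open import Induction.WellFounded using (WellFounded)
open import Level using (0ℓ)
open import Relation.Binary.Construct.Closure.ReflexiveTransitive using (Star)
open import Relation.Binary.PropositionalEquality using (_≡_)
open import Relation.Binary.Structures using (IsStrictTotalOrder)
open import Relation.Nullary using (¬_)
open import Relation.Unary using (Pred; _∈_; _⊆_; _≐_; _∪_; ｛_｝; Empty; Satisfiable)

data Four : Set where
  𝐭 𝐟 𝐮 𝐢 : Four

-- A truth value is given by the evidence for and the evidence against.
-- This is the same encoding as that of a structure by a set of literals,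
-- and it provides infima and suprema over arbitrary families.
record Value : Set₁ where
  constructor ⟨_,_⟩
  field
    for     : Set
    against : Set

open Value public

infix 4 _is_ _≤ₜ_

_is_ : Value → Four → Set
v is 𝐭 = for v × ¬ against v
v is 𝐟 = ¬ for v × against v
v is 𝐮 = ¬ for v × ¬ against v
v is 𝐢 = for v × against v

-- The truth order: 𝐟 is least, 𝐭 is greatest, 𝐮 and 𝐢 are incomparable.
_≤ₜ_ : Value → Value → Set
v ≤ₜ w = (for v → for w) × (against w → against v)

infix 8 ∼_
infixr 7 _⊓_
infixr 6 _⊔_

∼_ : Value → Value
∼ v = ⟨ against v , for v ⟩

_⊓_ _⊔_ : Value → Value → Value
v ⊓ w = ⟨ for v × for w , against v ⊎ against w ⟩
v ⊔ w = ⟨ for v ⊎ for w , against v × against w ⟩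

⨅ ⨆ : {I : Set} → (I → Value) → Value
⨅ {I} f = ⟨ (∀ i → for (f i)) , Σ I (λ i → against (f i)) ⟩
⨆ {I} f = ⟨ Σ I (λ i → for (f i)) , (∀ i → against (f i)) ⟩

⊓-lowerˡ : ∀ v w → v ⊓ w ≤ₜ v
⊓-lowerˡ _ _ = proj₁ , inj₁

⊓-lowerʳ : ∀ v w → v ⊓ w ≤ₜ w
⊓-lowerʳ _ _ = proj₂ , inj₂

⊓-greatest : ∀ {u v w} → u ≤ₜ v → u ≤ₜ w → u ≤ₜ v ⊓ w
⊓-greatest (p , q) (p′ , q′) =
  (λ x → p x , p′ x) , λ { (inj₁ y) → q y ; (inj₂ y) → q′ y }

⊔-upperˡ : ∀ v w → v ≤ₜ v ⊔ w
⊔-upperˡ _ _ = inj₁ , proj₁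

⊔-upperʳ : ∀ v w → w ≤ₜ v ⊔ w
⊔-upperʳ _ _ = inj₂ , proj₂

⊔-least : ∀ {u v w} → v ≤ₜ u → w ≤ₜ u → v ⊔ w ≤ₜ u
⊔-least (p , q) (p′ , q′) =
  (λ { (inj₁ x) → p x ; (inj₂ x) → p′ x }) , λ y → q y , q′ y

⨅-lower : {I : Set} (f : I → Value) → ∀ i → ⨅ f ≤ₜ f i
⨅-lower f i = (λ x → x i) , (λ y → i , y)

⨅-greatest : {I : Set} (f : I → Value) → ∀ {u} → (∀ i → u ≤ₜ f i) → u ≤ₜ ⨅ f
⨅-greatest f h = (λ x i → proj₁ (h i) x) , λ { (i , y) → proj₂ (h i) y }

⨆-upper : {I : Set} (f : I → Value) → ∀ i → f i ≤ₜ ⨆ f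
⨆-upper f i = (λ x → i , x) , (λ y → y i)

⨆-least : {I : Set} (f : I → Value) → ∀ {u} → (∀ i → f i ≤ₜ u) → ⨆ f ≤ₜ u
⨆-least f h = (λ { (i , x) → proj₁ (h i) x }) , λ y i → proj₂ (h i) y

record Signature : Set₁ where
  field
    D         : Set
    Predicate : ℕ → Set  -- indexed by arity

module Logic (Sg : Signature) where

  open Signature Sg

  data Symbol : ℕ → Set where
    ⊤ₛ ⊥ₛ : Symbol 0
    pred  : ∀ {n} → Predicate n → Symbol n

  Vocabulary : Set₁
  Vocabulary = Pred (∃ Symbol) 0ℓ

  record Atom : Set where
    constructor _·_
    field
      {arity} : ℕ
      symbol  : Symbol arity
      args    : Vec D arity

  open Atom public

  data Literal : Set where
    pos neg : Atom → Literal

  atom : Literal → Atom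
  atom (pos a) = a
  atom (neg a) = a

  atomsOf : Vocabulary → Pred Atom 0ℓ
  atomsOf V a = (arity a , symbol a) ∈ V

  Structure : Set₁
  Structure = Pred Literal 0ℓ

  -- The literals holding in a structure: ⊤ₛ and ⊥ₛ have a fixed
  -- interpretation, whatever the underlying set says about them.
  ⟪_⟫ : Structure → Pred Literal 0ℓ
  ⟪ S ⟫ (pos (⊤ₛ · _)) = ⊤
  ⟪ S ⟫ (neg (⊤ₛ · _)) = ⊥
  ⟪ S ⟫ (pos (⊥ₛ · _)) = ⊥
  ⟪ S ⟫ (neg (⊥ₛ · _)) = ⊤
  ⟪ S ⟫ (pos (pred P · d)) = pos (pred P · d) ∈ S
  ⟪ S ⟫ (neg (pred P · d)) = neg (pred P · d) ∈ S

  infix 4 _≈_ _≥ₚ_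
  infixl 7 _∣_

  _≈_ : Structure → Structure → Set
  S ≈ S′ = ⟪ S ⟫ ≐ ⟪ S′ ⟫

  _≥ₚ_ : Structure → Structure → Set
  S′ ≥ₚ S = ⟪ S ⟫ ⊆ ⟪ S′ ⟫

  value : Structure → Atom → Value
  value S a = ⟨ pos a ∈ ⟪ S ⟫ , neg a ∈ ⟪ S ⟫ ⟩

  literalValue : Structure → Literal → Value
  literalValue S (pos a) = value S a
  literalValue S (neg a) = ∼ value S a

  _∣_ : Structure → Pred Atom 0ℓ → Structure
  (S ∣ σ) l = l ∈ S × atom l ∈ σ

  ConsistentStructure : Structure → Set
  ConsistentStructure S = ∀ a → ¬ (value S a is 𝐢)

  TwoValuedOn : Pred Atom 0ℓ → Structure → Set
  TwoValuedOn σ S = ∀ a → a ∈ σ → (value S a is 𝐭) ⊎ (value S a is 𝐟)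

  StructureOf : Pred Atom 0ℓ → Structure → Set
  StructureOf σ S = S ≈ S ∣ σ

  TwoValuedStructureOf : Pred Atom 0ℓ → Structure → Set
  TwoValuedStructureOf σ S = StructureOf σ S × TwoValuedOn σ S

  data Term (n : ℕ) : Set where
    var  : Fin n → Term n
    elem : D → Term n

  -- Formula n has free variables among n de Bruijn indices; the
  -- quantifiers bind index zero.
  data Formula (n : ℕ) : Set₁ where
    atm     : ∀ {k} → Symbol k → Vec (Term n) k → Formula n
    ¬̇_      : Formula n → Formula n
    _∧̇_ _∨̇_ : Formula n → Formula n → Formula n
    ∀̇ ∃̇     : Pred D 0ℓ → Formula (suc n) → Formula n

  data NNF {n : ℕ} : Formula n → Set₁ where
    atm  : ∀ {k} {s : Symbol k} {ts} → NNF (atm s ts)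
    ¬atm : ∀ {k} {s : Symbol k} {ts} → NNF (¬̇ (atm s ts))
    _∧̇_  : ∀ {φ ψ} → NNF φ → NNF ψ → NNF (φ ∧̇ ψ)
    _∨̇_  : ∀ {φ ψ} → NNF φ → NNF ψ → NNF (φ ∨̇ ψ)
    ∀̇    : ∀ {D′ φ} → NNF φ → NNF (∀̇ D′ φ)
    ∃̇    : ∀ {D′ φ} → NNF φ → NNF (∃̇ D′ φ)

  ⟦_⟧ₜ : ∀ {n} → Term n → Vec D n → D
  ⟦ var x  ⟧ₜ ρ = Vec.lookup ρ x
  ⟦ elem d ⟧ₜ ρ = d

  -- ⟦ φ ⟧ S d̄ is the truth value of φ[x̄/d̄] in S.
  ⟦_⟧ : ∀ {n} → Formula n → Structure → Vec D n → Value
  ⟦ atm s ts ⟧ S ρ = value S (s · Vec.map (λ t → ⟦ t ⟧ₜ ρ) ts)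
  ⟦ ¬̇ φ      ⟧ S ρ = ∼ ⟦ φ ⟧ S ρ
  ⟦ φ ∧̇ ψ    ⟧ S ρ = ⟦ φ ⟧ S ρ ⊓ ⟦ ψ ⟧ S ρ
  ⟦ φ ∨̇ ψ    ⟧ S ρ = ⟦ φ ⟧ S ρ ⊔ ⟦ ψ ⟧ S ρ
  ⟦ ∀̇ D′ φ   ⟧ S ρ = ⨅ {∃ D′} (λ d → ⟦ φ ⟧ S (proj₁ d ∷ ρ))
  ⟦ ∃̇ D′ φ   ⟧ S ρ = ⨆ {∃ D′} (λ d → ⟦ φ ⟧ S (proj₁ d ∷ ρ))

  symbols : ∀ {n} → Formula n → Vocabulary
  symbols (atm s ts) = ｛ (_ , s) ｝
  symbols (¬̇ φ)      = symbols φ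
  symbols (φ ∧̇ ψ)    = symbols φ ∪ symbols ψ
  symbols (φ ∨̇ ψ)    = symbols φ ∪ symbols ψ
  symbols (∀̇ D′ φ)   = symbols φ
  symbols (∃̇ D′ φ)   = symbols φ

  GroundTerm : ∀ {n} → Term n → Set
  GroundTerm t = ∃ λ d → t ≡ elem d

  GroundFormula : ∀ {n} → Formula n → Set
  GroundFormula (atm s ts) = ∀ i → GroundTerm (Vec.lookup ts i)
  GroundFormula (¬̇ φ)      = GroundFormula φ
  GroundFormula (φ ∧̇ ψ)    = GroundFormula φ × GroundFormula ψ
  GroundFormula (φ ∨̇ ψ)    = GroundFormula φ × GroundFormula ψ
  GroundFormula (∀̇ D′ φ)   = ⊥
  GroundFormula (∃̇ D′ φ)   = ⊥

  -- ∀ x̄ ∈ range : head(x̄) ← body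
  record Rule : Set₁ where
    field
      {n}   : ℕ
      head  : Predicate n
      range : Pred (Vec D n) 0ℓ
      body  : Formula n
      nnf   : NNF body

  open Rule public using (head; range; body)

  data _defines_ (r : Rule) : Atom → Set where
    instance-at : ∀ d̄ → d̄ ∈ range r → r defines (pred (head r) · d̄)

  bodyValue : ∀ {r a} → r defines a → Structure → Value
  bodyValue {r} (instance-at d̄ _) S = ⟦ body r ⟧ S d̄

  -- A ground rule P(d̄) ← φ is the rule ∀ x̄ ∈ {d̄} : P(x̄) ← φ, φ variable-free.
  GroundRule : Rule → Set
  GroundRule r = (∃ λ d̄ → range r ≐ ｛ d̄ ｝) × GroundFormula (body r)

  RuleSet : Set₁
  RuleSet = List Rule

  voc : RuleSet → Vocabulary
  voc Δ s = ∃ λ i → s ≡ (_ , pred (head (lookup Δ i))) ⊎ s ∈ symbols (body (lookup Δ i))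

  Defined : RuleSet → Pred Atom 0ℓ
  Defined Δ a = ∃ λ i → lookup Δ i defines a

  Open : RuleSet → Pred Atom 0ℓ
  Open Δ a = a ∈ atomsOf (voc Δ) × ¬ (a ∈ Defined Δ)

  IsDefinition : RuleSet → Set₁
  IsDefinition Δ = ∀ a i j → lookup Δ i defines a → lookup Δ j defines a → lookup Δ i ≡ lookup Δ j

  -- a is defined by Δ, and the body instance of a has value v in S.
  BodyOf_In_At_Is_ : Atom → RuleSet → Structure → Four → Set
  BodyOf a In Δ At S Is v = ∃ λ i → Σ (lookup Δ i defines a) λ r → bodyValue r S is v

  falsified : Pred Atom 0ℓ → Structure
  falsified U (pos a) = ⊥
  falsified U (neg a) = a ∈ U

  -- U is non-empty, as otherwise every structure would refine itself and no
  -- process would be maximal.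
  data Refines (Δ : RuleSet) (S S′ : Structure) : Set₁ where
    make-true :
      ∀ a → a ∈ Defined Δ → value S a is 𝐮 →
      BodyOf a In Δ At S Is 𝐭 →
      S′ ≈ S ∪ ｛ pos a ｝ →
      Refines Δ S S′
    make-false :
      (U : Pred Atom 0ℓ) → Satisfiable U →
      (∀ a → a ∈ U → a ∈ Defined Δ × (value S a is 𝐮)) →
      S′ ≈ S ∪ falsified U →
      (∀ a → a ∈ U → BodyOf a In Δ At S′ Is 𝐟) →
      Refines Δ S S′

  -- Transfinite sequences of refinements, indexed by a well-ordered set
  -- of stages with a last element.
  record RefinementProcess (Δ : RuleSet) (start : Structure) : Set₁ where
    field
      Stage              : Set
      _<_                : Stage → Stage → Set
      isStrictTotalOrder : IsStrictTotalOrder _≡_ _<_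
      wellFounded        : WellFounded _<_
      at                 : Stage → Structure
      last               : Stage
      last-is-last       : ∀ α → ¬ (last < α)

    IsZero : Stage → Set
    IsZero α = ∀ β → ¬ (β < α)

    IsSuccessorOf : Stage → Stage → Set
    IsSuccessorOf β α = β < α × (∀ γ → ¬ (β < γ × γ < α))

    IsLimit : Stage → Set
    IsLimit α = ¬ IsZero α × (∀ β → ¬ IsSuccessorOf β α)

    field
      at-zero      : ∀ α → IsZero α → at α ≈ start
      at-successor : ∀ α β → IsSuccessorOf β α → Refines Δ (at β) (at α)
      at-limit     : ∀ α → IsLimit α → at α ≈ (λ l → ∃ λ β → β < α × l ∈ at β)

    limit : Structure
    limit = at last

    Maximal : Set₁
    Maximal = ∀ S → ¬ Refines Δ limit S

  -- W is wf_Δ(I), for I a structure of Open Δ.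
  IsWellFoundedModel : (Δ : RuleSet) (I W : Structure) → Set₁
  IsWellFoundedModel Δ I W =
    Σ (RefinementProcess Δ I) λ p →
      RefinementProcess.Maximal p × (W ≈ RefinementProcess.limit p)

  -- M may interpret symbols outside voc Δ; these are unconstrained.
  IsModel : RuleSet → Structure → Set₁
  IsModel Δ M =
    TwoValuedOn (atomsOf (voc Δ)) M ×
    IsWellFoundedModel Δ (M ∣ Open Δ) (M ∣ atomsOf (voc Δ))

  IsTotal : RuleSet → Set₁
  IsTotal Δ =
    ∀ I → TwoValuedStructureOf (Open Δ) I →
    ∃ λ W → IsWellFoundedModel Δ I W × TwoValuedOn (atomsOf (voc Δ)) W

  IsTotalDefinition : RuleSet → Set₁
  IsTotalDefinition Δ = IsDefinition Δ × IsTotal Δ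

  -- When theories are compared over Σ′, their models are the two-valued
  -- structures of the vocabulary voc Δ ∪ Σ′ satisfying Δ.
  IsModelOver : Vocabulary → RuleSet → Structure → Set₁
  IsModelOver Σ′ Δ M = TwoValuedStructureOf (atomsOf (voc Δ ∪ Σ′)) M × IsModel Δ M

  UniquelyExpandable : Vocabulary → RuleSet → RuleSet → Set₁
  UniquelyExpandable Σ′ Δ Δ′ =
    ∀ M → IsModelOver Σ′ Δ M →
    ∃ λ M′ → Expansion M M′ × (∀ M″ → Expansion M M″ → M″ ≈ M′)
    where
    Expansion : Structure → Structure → Set₁
    Expansion M M′ = IsModelOver Σ′ Δ′ M′ × (M′ ≥ₚ M ∣ atomsOf Σ′)

  StronglyEquivalent : Vocabulary → RuleSet → RuleSet → Set₁
  StronglyEquivalent Σ′ Δ Δ′ = UniquelyExpandable Σ′ Δ Δ′ × UniquelyExpandable Σ′ Δ′ Δ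

  record CanonicalTheory : Set₁ where
    field
      P-𝒯 : Predicate 0
      Δ   : RuleSet

    P-𝒯-atom : Atom
    P-𝒯-atom = pred P-𝒯 · []

    field
      total   : IsTotalDefinition Δ
      defined : P-𝒯-atom ∈ Defined Δ

  IsTheoryModel : CanonicalTheory → Structure → Set₁
  IsTheoryModel 𝒯 M = IsModel Δ M × (value M P-𝒯-atom is 𝐭)
    where open CanonicalTheory 𝒯

  ConsistentSet : Pred Literal 0ℓ → Set
  ConsistentSet S = ∀ a → ¬ (pos a ∈ S × neg a ∈ S)

  IsDirectJustification : RuleSet → Literal → Pred Literal 0ℓ → Set
  IsDirectJustification Δ l S = ConsistentSet S × Satisfiable S × establishes l
    where
    establishes : Literal → Set
    establishes (pos a) = BodyOf a In Δ At S Is 𝐭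
    establishes (neg a) = BodyOf a In Δ At S Is 𝐟

  -- A directed graph, given by the set of children of each node.
  Graph : Set₁
  Graph = Literal → Pred Literal 0ℓ

  IsJustification : RuleSet → Graph → Set
  IsJustification Δ J = ∀ l → Empty (J l) ⊎ IsDirectJustification Δ l (J l)

  ReachableFrom : Graph → Pred Literal 0ℓ → Pred Literal 0ℓ
  ReachableFrom J L l = ∃ λ l₀ → l₀ ∈ L × Star J l₀ l

  IsTotalFor : RuleSet → Graph → Pred Literal 0ℓ → Set
  IsTotalFor Δ J L =
    ∀ l → atom l ∈ Defined Δ → l ∈ ReachableFrom J L → Satisfiable (J l)

  InfinitePathIn : Graph → Literal → (ℕ → Literal) → Set
  InfinitePathIn J l p =
    (∀ k → p k ∈ ReachableFrom J ｛ l ｝) × (∀ k → p (suc k) ∈ J (p k))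

  IsNegative : Literal → Set
  IsNegative l = ∃ λ a → l ≡ neg a

  IsWellFoundedIn : Graph → Literal → Set
  IsWellFoundedIn J l = ∀ p → InfinitePathIn J l p → ∀ k → IsNegative (p k)

  Justifies : RuleSet → Graph → Pred Literal 0ℓ → Set
  Justifies Δ J L =
    IsTotalFor Δ J L ×
    (∀ l → l ∈ L → IsWellFoundedIn J l) ×
    ConsistentSet (ReachableFrom J L)

  -- The first argument is the set of literals occurring in the justification.
  ConsistentWith : Pred Literal 0ℓ → Structure → Set
  ConsistentWith N I = ConsistentStructure I × (∀ l → l ∈ N → ¬ (literalValue I l is 𝐟))

  record AcceptableState (𝒯 : CanonicalTheory) (I-in : Structure)
                         (Δg Δd : RuleSet) (J : Graph) (I : Structure) : Set₁ where
    open CanonicalTheory 𝒯 using (Δ)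

    Δgd : RuleSet
    Δgd = Δg ++ Δd

    L : Pred Literal 0ℓ
    L l = (literalValue I l is 𝐭) × atom l ∈ Defined Δd

    field
      ground          : ∀ i → GroundRule (lookup Δg i)
      total-gd        : IsTotalDefinition Δgd
      total-g         : IsTotalDefinition Δg
      total-d         : IsTotalDefinition Δd
      equivalent      : StronglyEquivalent (voc Δ) Δgd Δ
      disjoint        : ∀ a → ¬ (a ∈ Defined Δg × a ∈ Defined Δd)
      justification   : IsJustification Δgd J
      expands-input   : I ≥ₚ I-in
      justified       : Justifies Δgd J L
      consistent-with : ConsistentWith (ReachableFrom J L) I

module Submission where

open import Axiom.ExcludedMiddle using (ExcludedMiddle)
open import Data.Empty using (⊥; ⊥-elim)
open import Data.Fin using (zero; suc)
open import Data.List using ([]; _∷_; lookup; _++_)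
open import Data.Nat using (ℕ; zero; suc)
open import Data.Product using (Σ; ∃; _×_; _,_; proj₁; proj₂; map)
open import Data.Sum using (_⊎_; inj₁; inj₂; [_,_]′; map₁; map₂) renaming (map to ⊎-map)
open import Data.Unit using (⊤; tt)
open import Function using (id; _∘_)
open import Induction.WellFounded using (Acc; acc)
open import Level using (0ℓ)
open import Relation.Binary.Construct.Closure.ReflexiveTransitive using (Star; ε; _◅_; _◅◅_)
open import Relation.Binary.Definitions using (tri<; tri≈; tri>)
open import Relation.Binary.PropositionalEquality using (_≡_; refl)
open import Relation.Binary.Structures using (IsStrictTotalOrder)
open import Relation.Nullary using (¬_; yes; no; contradiction)
open import Relation.Nullary.Decidable using (toSum)
open import Relation.Unary using (Pred; _∈_; _∉_; _⊆_; _∪_; ｛_｝)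
open import Relation.Unary.Properties using (≐-sym; ≐-trans)
open import Defs

-- Totality gives a two-valued well-founded model W of Δg ∪ Δd extending an
-- assignment of its open atoms that makes all open literals of J_L and of I
-- true. No literal of J_L is ever contradicted in the process leading to W:
-- at the first such stage, a contradicted negative literal would need an
-- earlier contradicted child, and a contradicted positive literal would start
-- an infinite path of positive literals. Hence W contains L, so it agrees with I
-- on the open atoms of Δg. Every step of the process of Δg towards I is then
-- compatible with the process towards W, so W agrees with I on voc(Δg).
-- Finally W transfers to Δ by strong equivalence.

-- Rules of a concatenation of rule sets.

lookup-++⁺ˡ : ∀ {a p} {A : Set a} (P : A → Set p) xs ys →
              (∃ λ i → P (lookup xs i)) → ∃ λ j → P (lookup (xs ++ ys) j)
lookup-++⁺ˡ P (_ ∷ _)  ys (zero , p)  = zero , p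
lookup-++⁺ˡ P (_ ∷ xs) ys (suc i , p) = map suc id (lookup-++⁺ˡ P xs ys (i , p))

lookup-++⁻ : ∀ {a p} {A : Set a} (P : A → Set p) xs ys → (∃ λ j → P (lookup (xs ++ ys) j)) →
             (∃ λ i → P (lookup xs i)) ⊎ (∃ λ i → P (lookup ys i))
lookup-++⁻ P []       ys p           = inj₂ p
lookup-++⁻ P (_ ∷ _)  ys (zero , p)  = inj₁ (zero , p)
lookup-++⁻ P (_ ∷ xs) ys (suc j , p) = map₁ (map suc id) (lookup-++⁻ P xs ys (j , p))

module WellFoundedModels (em : ∀ {ℓ} → ExcludedMiddle ℓ) (Sg : Signature) where

  open Logic Sg

  private variable
    S S′ T T′ start start′ : Structure
    σ τ : Pred Atom 0ℓ
    Δ : RuleSet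
    a : Atom
    l : Literal

  decide : ∀ {p} (P : Set p) → P ⊎ ¬ P
  decide P = toSum (em {P = P})

  -- Literals holding in a structure, inclusion and restriction.

  opposite : Literal → Literal
  opposite (pos a) = neg a
  opposite (neg a) = pos a

  infix 4 _⊨_ _⊑_

  -- A record, so that S and l can be inferred from the type.
  record _⊨_ (S : Structure) (l : Literal) : Set where
    constructor holds
    field literal-holds : l ∈ ⟪ S ⟫

  open _⊨_

  _⊑_ : Structure → Structure → Set
  S ⊑ T = ∀ {l} → S ⊨ l → T ⊨ l

  ≥ₚ⇒⊑ : ∀ S T → T ≥ₚ S → S ⊑ T
  ≥ₚ⇒⊑ S T h {l} (holds x) = holds (h {l} x)

  ⊑⇒≥ₚ : ∀ S T → S ⊑ T → T ≥ₚ S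
  ⊑⇒≥ₚ S T h {l} x = literal-holds (h {l} (holds x))

  ≈⇒⊑ : ∀ S T → S ≈ T → S ⊑ T
  ≈⇒⊑ S T (to , _) {l} (holds x) = holds (to {l} x)

  ≈⇒⊒ : ∀ S T → S ≈ T → T ⊑ S
  ≈⇒⊒ S T (_ , from) {l} (holds x) = holds (from {l} x)

  ⊑⊒⇒≈ : ∀ S T → S ⊑ T → T ⊑ S → S ≈ T
  ⊑⊒⇒≈ S T to from = (λ {l} → ⊑⇒≥ₚ S T to {l}) , (λ {l} → ⊑⇒≥ₚ T S from {l})

  -- Literals that hold by the fixed interpretation of `⊤ₛ` and `⊥ₛ` are charged to `S`. The other
  -- case can therefore report membership in the underlying set `T`, which later identifies the
  -- literal added by a refinement.
  ∪⁻ : ∀ S T {l} → S ∪ T ⊨ l → S ⊨ l ⊎ l ∈ T × T ⊨ l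
  ∪⁻ S T {pos (⊤ₛ · _)}     (holds x)        = inj₁ (holds x)
  ∪⁻ S T {neg (⊥ₛ · _)}     (holds x)        = inj₁ (holds x)
  ∪⁻ S T {pos (pred _ · _)} (holds (inj₁ x)) = inj₁ (holds x)
  ∪⁻ S T {pos (pred _ · _)} (holds (inj₂ x)) = inj₂ (x , holds x)
  ∪⁻ S T {neg (pred _ · _)} (holds (inj₁ x)) = inj₁ (holds x)
  ∪⁻ S T {neg (pred _ · _)} (holds (inj₂ x)) = inj₂ (x , holds x)

  ⊆⇒⊑ : ∀ S T → S ⊆ T → S ⊑ T
  ⊆⇒⊑ S T h {pos (⊤ₛ · _)}     (holds x) = holds x
  ⊆⇒⊑ S T h {neg (⊥ₛ · _)}     (holds x) = holds x
  ⊆⇒⊑ S T h {pos (pred _ · _)} (holds x) = holds (h x)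
  ⊆⇒⊑ S T h {neg (pred _ · _)} (holds x) = holds (h x)

  ∣⁺ : ∀ σ → S ⊨ l → atom l ∈ σ → S ∣ σ ⊨ l
  ∣⁺ {l = pos (⊤ₛ · _)}     _ (holds x) _ = holds x
  ∣⁺ {l = neg (⊥ₛ · _)}     _ (holds x) _ = holds x
  ∣⁺ {l = pos (pred _ · _)} _ (holds x) y = holds (x , y)
  ∣⁺ {l = neg (pred _ · _)} _ (holds x) y = holds (x , y)

  -- These are exactly the true literals of `⊤ₛ` and `⊥ₛ`, since the empty structure satisfies
  -- nothing else.
  Valid : Literal → Set₁
  Valid l = ∀ T → T ⊨ l

  -- Restriction does not remove the fixed interpretation of ⊤ₛ and ⊥ₛ.
  ∣⁻ : ∀ σ → S ∣ σ ⊨ l → Valid l ⊎ S ⊨ l × atom l ∈ σ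
  ∣⁻ {l = pos (⊤ₛ · _)}     _ (holds x)       = inj₁ (λ _ → holds x)
  ∣⁻ {l = neg (⊥ₛ · _)}     _ (holds x)       = inj₁ (λ _ → holds x)
  ∣⁻ {l = pos (pred _ · _)} _ (holds (x , y)) = inj₂ (holds x , y)
  ∣⁻ {l = neg (pred _ · _)} _ (holds (x , y)) = inj₂ (holds x , y)

  ∣-⊑ : ∀ σ → (∀ {l} → S ⊨ l → atom l ∈ σ → T ⊨ l) → S ∣ σ ⊑ T
  ∣-⊑ σ h x with ∣⁻ σ x
  ... | inj₁ v       = v _
  ... | inj₂ (y , z) = h y z

  ∣⊑ : ∀ S σ → S ∣ σ ⊑ S
  ∣⊑ S σ = ⊆⇒⊑ (S ∣ σ) S proj₁

  -- Clashes between two structures that disagree on a formula.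

  Clash : Structure → Structure → Set
  Clash S S′ = ∃ λ l → S ⊨ l × S′ ⊨ opposite l

  clash-sym : Clash S S′ → Clash S′ S
  clash-sym (pos a , x , y) = neg a , y , x
  clash-sym (neg a , x , y) = pos a , y , x

  -- ⊤ₛ and ⊥ₛ do not clash, so a clash occurs in the underlying sets.
  clash-∈ : S ⊨ l → S′ ⊨ opposite l → l ∈ S × opposite l ∈ S′
  clash-∈ {l = pos (pred _ · _)} (holds x) (holds y) = x , y
  clash-∈ {l = neg (pred _ · _)} (holds x) (holds y) = x , y
  clash-∈ {l = pos (⊤ₛ · _)} _ (holds ())
  clash-∈ {l = pos (⊥ₛ · _)} (holds ())
  clash-∈ {l = neg (⊤ₛ · _)} (holds ())
  clash-∈ {l = neg (⊥ₛ · _)} _ (holds ())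

  valid-no-clash : Valid l → ¬ S ⊨ opposite l
  valid-no-clash v y = proj₁ (clash-∈ (v (λ _ → ⊥)) y)

  -- At each connective one side's evidence is a choice and the other side's covers every choice, so
  -- following the choice leads down to a single literal. Negation exchanges the two structures.
  formula-clash : ∀ {n} (φ : Formula n) {ρ} →
                  for (⟦ φ ⟧ S ρ) → against (⟦ φ ⟧ S′ ρ) → Clash S S′
  formula-clash (atm s ts) x y = pos (s · _) , holds x , holds y
  formula-clash (¬̇ φ) x y = clash-sym (formula-clash φ y x)
  formula-clash (φ ∧̇ ψ) (x , _) (inj₁ y) = formula-clash φ x y
  formula-clash (φ ∧̇ ψ) (_ , x) (inj₂ y) = formula-clash ψ x y
  formula-clash (φ ∨̇ ψ) (inj₁ x) (y , _) = formula-clash φ x y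
  formula-clash (φ ∨̇ ψ) (inj₂ x) (_ , y) = formula-clash ψ x y
  formula-clash (∀̇ _ φ) x (d , y) = formula-clash φ (x d) y
  formula-clash (∃̇ _ φ) (d , x) y = formula-clash φ x (y d)

  rule-clash : ∀ {r r′} → r ≡ r′ → (p : r defines a) (q : r′ defines a) →
               for (bodyValue p S) → against (bodyValue q S′) → Clash S S′
  rule-clash {r = r} refl (instance-at d̄ _) (instance-at .d̄ _) = formula-clash (body r)

  -- An atom has at most one rule, so both bodies are the same formula instance. All later conflicts
  -- between derivations and justifications are reduced to a literal in this way.
  body-clash : ∀ Δ S S′ → IsDefinition Δ →
               BodyOf a In Δ At S Is 𝐭 → BodyOf a In Δ At S′ Is 𝐟 → Clash S S′
  body-clash _ _ _ def (i , p , x , _) (j , q , _ , y) = rule-clash (def _ i j p q) p q x y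

  Defined⇒voc : ∀ Δ → Defined Δ ⊆ atomsOf (voc Δ)
  Defined⇒voc _ (i , instance-at _ _) = i , inj₁ refl

  valid-not-defined : ∀ Δ l → Valid l → atom l ∉ Defined Δ
  valid-not-defined Δ (pos _) v (_ , instance-at _ _) = literal-holds (v (λ _ → ⊥))
  valid-not-defined Δ (neg _) v (_ , instance-at _ _) = literal-holds (v (λ _ → ⊥))

  body⇒Defined : ∀ Δ S v → BodyOf a In Δ At S Is v → a ∈ Defined Δ
  body⇒Defined _ _ _ (i , r , _) = i , r

  -- Two-valued structures.

  record TwoValued (σ : Pred Atom 0ℓ) (S : Structure) : Set where
    field
      complete   : ∀ l → atom l ∈ σ → S ⊨ l ⊎ S ⊨ opposite l
      consistent : ∀ l → atom l ∈ σ → S ⊨ l → ¬ S ⊨ opposite l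

  open TwoValued

  two-valued⁺ : TwoValuedOn σ S → TwoValued σ S
  two-valued⁺ tv .complete (pos a) x = [ inj₁ ∘ holds ∘ proj₁ , inj₂ ∘ holds ∘ proj₂ ]′ (tv a x)
  two-valued⁺ tv .complete (neg a) x = [ inj₂ ∘ holds ∘ proj₁ , inj₁ ∘ holds ∘ proj₂ ]′ (tv a x)
  two-valued⁺ tv .consistent (pos a) x (holds p) (holds n) =
    [ (λ t → proj₂ t n) , (λ f → proj₁ f p) ]′ (tv a x)
  two-valued⁺ tv .consistent (neg a) x (holds n) (holds p) =
    [ (λ t → proj₂ t n) , (λ f → proj₁ f p) ]′ (tv a x)

  two-valued⁻ : TwoValued σ S → TwoValuedOn σ S
  two-valued⁻ tv a x with complete tv (pos a) x
  ... | inj₁ p = inj₁ (literal-holds p , consistent tv (pos a) x p ∘ holds)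
  ... | inj₂ n = inj₂ (consistent tv (neg a) x n ∘ holds , literal-holds n)

  two-valued-⊆ : τ ⊆ σ → TwoValued σ S → TwoValued τ S
  two-valued-⊆ τ⊆σ S₂ .complete l x   = complete S₂ l (τ⊆σ x)
  two-valued-⊆ τ⊆σ S₂ .consistent l x = consistent S₂ l (τ⊆σ x)

  two-valued-∣ : TwoValued σ S → TwoValued σ (S ∣ σ)
  two-valued-∣ {σ} S₂ .complete l@(pos _) x =
    [ (λ y → inj₁ (∣⁺ σ y x)) , (λ y → inj₂ (∣⁺ σ y x)) ]′ (complete S₂ l x)
  two-valued-∣ {σ} S₂ .complete l@(neg _) x =
    [ (λ y → inj₁ (∣⁺ σ y x)) , (λ y → inj₂ (∣⁺ σ y x)) ]′ (complete S₂ l x)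
  two-valued-∣ {σ} {S} S₂ .consistent l x y z =
    consistent S₂ l x (∣⊑ S σ y) (∣⊑ S σ z)

  two-valued-resp : S ⊑ T → T ∣ σ ⊑ S → TwoValued σ S → TwoValued σ T
  two-valued-resp to from S₂ .complete l x = [ inj₁ ∘ to , inj₂ ∘ to ]′ (complete S₂ l x)
  two-valued-resp {σ = σ} to from S₂ .consistent (pos a) x p n =
    consistent S₂ (pos a) x (from (∣⁺ σ p x)) (from (∣⁺ σ n x))
  two-valued-resp {σ = σ} to from S₂ .consistent (neg a) x n p =
    consistent S₂ (neg a) x (from (∣⁺ σ n x)) (from (∣⁺ σ p x))

  -- If `S` lacked a literal of `T`, it would contain the opposite one, and then so would `T`. Hence
  -- inclusion between structures two-valued on `σ` is agreement on `σ`.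
  two-valued-⊒ : TwoValued σ S → TwoValued σ T → S ∣ σ ⊑ T → T ∣ σ ⊑ S
  two-valued-⊒ {σ} {S} {T} S₂ T₂ h = ∣-⊑ σ half
    where
    half : ∀ {l} → T ⊨ l → atom l ∈ σ → S ⊨ l
    half {l} t x with complete S₂ l x
    half {l}     t x | inj₁ s = s
    half {pos a} t x | inj₂ s = ⊥-elim (consistent T₂ (pos a) x t (h (∣⁺ σ s x)))
    half {neg a} t x | inj₂ s = ⊥-elim (consistent T₂ (neg a) x t (h (∣⁺ σ s x)))

  ∣-mono-⊑ : ∀ σ τ → τ ⊆ σ → S ∣ σ ⊑ T → S ∣ τ ⊑ T ∣ τ
  ∣-mono-⊑ σ τ τ⊆σ h = ∣-⊑ τ λ s x → ∣⁺ τ (h (∣⁺ σ s (τ⊆σ x))) x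

  two-valued-≈ : ∀ {S T} τ → τ ⊆ σ → TwoValued σ S → TwoValued σ T → S ∣ σ ⊑ T → S ∣ τ ≈ T ∣ τ
  two-valued-≈ {σ} {S} {T} τ τ⊆σ S₂ T₂ h = ⊑⊒⇒≈ (S ∣ τ) (T ∣ τ)
    (∣-mono-⊑ σ τ τ⊆σ h) (∣-mono-⊑ σ τ τ⊆σ (two-valued-⊒ S₂ T₂ h))

  -- Closed-world completion of a consistent set of literals.

  completion : Pred Literal 0ℓ → Structure
  completion N (pos a) = pos a ∈ N
  completion N (neg a) = pos a ∉ N

  module _ {N : Pred Literal 0ℓ} where

    completion-two-valued : TwoValuedOn σ (completion N)
    completion-two-valued (⊤ₛ · _) _ = inj₁ (tt , id)
    completion-two-valued (⊥ₛ · _) _ = inj₂ (id , tt)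
    completion-two-valued (pred P · d̄) _ with em {P = pos (pred P · d̄) ∈ N}
    ... | yes p = inj₁ (p , contradiction p)
    ... | no ¬p = inj₂ (¬p , ¬p)

    -- Since `N` contains the valid literals, its consistency excludes `pos` of `⊥ₛ` and `neg` of
    -- `⊤ₛ`, which hold in no structure.
    completion-⊨⁺ : ConsistentSet N → (∀ {l} → Valid l → l ∈ N) → ∀ l → l ∈ N → completion N ⊨ l
    completion-⊨⁺ con val (pos (⊤ₛ · _))     x = holds tt
    completion-⊨⁺ con val (neg (⊥ₛ · _))     x = holds tt
    completion-⊨⁺ con val (pos (⊥ₛ · _))     x = ⊥-elim (con _ (x , val λ _ → holds tt))
    completion-⊨⁺ con val (neg (⊤ₛ · _))     x = ⊥-elim (con _ ((val λ _ → holds tt) , x))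
    completion-⊨⁺ con val (pos (pred _ · _)) x = holds x
    completion-⊨⁺ con val (neg (pred _ · _)) x = holds λ y → con _ (y , x)

    completion-⊨⁻ : ConsistentSet N → (∀ {l} → Valid l → l ∈ N) →
                    ∀ l → completion N ⊨ l → opposite l ∉ N
    completion-⊨⁻ con val (pos a) x y with completion-⊨⁺ con val (neg a) y
    ... | z = consistent (two-valued⁺ {σ = λ _ → ⊤} completion-two-valued) (pos a) tt x z
    completion-⊨⁻ con val (neg a) x y with completion-⊨⁺ con val (pos a) y
    ... | z = consistent (two-valued⁺ {σ = λ _ → ⊤} completion-two-valued) (neg a) tt x z

  -- Single refinement steps.

  data Established (Δ : RuleSet) (S S′ : Structure) : Literal → Set where
    kept       : S ⊨ l → Established Δ S S′ l
    made-true  : BodyOf a In Δ At S Is 𝐭 → Established Δ S S′ (pos a)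
    made-false : BodyOf a In Δ At S′ Is 𝐟 → Established Δ S S′ (neg a)

  -- The body of an atom made true is evaluated before the step, that of an atom made false after
  -- it. This asymmetry is why positive and negative literals need different arguments below.
  established : Refines Δ S S′ → ∀ l → S′ ⊨ l → Established Δ S S′ l
  established {S = S} {S′} (make-true a _ _ b eq) l x
    with ∪⁻ S ｛ pos a ｝ (≈⇒⊑ S′ (S ∪ ｛ pos a ｝) eq x)
  ... | inj₁ s          = kept s
  ... | inj₂ (refl , _) = made-true b
  established {S = S} {S′} (make-false U _ _ eq b) l x
    with l | ∪⁻ S (falsified U) (≈⇒⊑ S′ (S ∪ falsified U) eq x)
  ... | _     | inj₁ s       = kept s
  ... | neg a | inj₂ (u , _) = made-false (b a u)

  established-atom : Established Δ S S′ l → S ⊨ l ⊎ atom l ∈ Defined Δ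
  established-atom (kept s) = inj₁ s
  established-atom {Δ = Δ} {S = S} (made-true b) = inj₂ (body⇒Defined Δ S 𝐭 b)
  established-atom {Δ = Δ} {S′ = S′} (made-false b) = inj₂ (body⇒Defined Δ S′ 𝐟 b)

  refines-⊑ : Refines Δ S S′ → S ⊑ S′
  refines-⊑ {S = S} {S′} (make-true a _ _ _ eq) =
    ≈⇒⊒ S′ (S ∪ ｛ pos a ｝) eq ∘ ⊆⇒⊑ S (S ∪ ｛ pos a ｝) inj₁
  refines-⊑ {S = S} {S′} (make-false U _ _ eq _) =
    ≈⇒⊒ S′ (S ∪ falsified U) eq ∘ ⊆⇒⊑ S (S ∪ falsified U) inj₁

  restart : start ≈ start′ → RefinementProcess Δ start → RefinementProcess Δ start′
  restart eq p = record
    { RefinementProcess p hiding (at-zero)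
    ; at-zero = λ α z → ≐-trans (RefinementProcess.at-zero p α z) eq
    }

  IsWellFoundedModel-resp-≈ : S ≈ S′ → T ≈ T′ →
    IsWellFoundedModel Δ S T → IsWellFoundedModel Δ S′ T′
  IsWellFoundedModel-resp-≈ S≈ T≈ (p , max , lim) = restart S≈ p , max , ≐-trans (≐-sym T≈) lim

  -- Transfinite refinement processes: monotonicity and induction.

  module Process {Δ : RuleSet} {start : Structure} (p : RefinementProcess Δ start) where

    open RefinementProcess p public
    open IsStrictTotalOrder isStrictTotalOrder using (compare)

    data StageKind (α : Stage) : Set where
      zeroˢ : IsZero α → StageKind α
      sucˢ  : ∀ β → IsSuccessorOf β α → StageKind α
      limˢ  : IsLimit α → StageKind α

    stageKind : ∀ α → StageKind α
    stageKind α with em {P = IsZero α}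
    ... | yes z = zeroˢ z
    ... | no ¬z with em {P = ∃ λ β → IsSuccessorOf β α}
    ...   | yes (β , s) = sucˢ β s
    ...   | no ¬s       = limˢ (¬z , λ β s → ¬s (β , s))

    Below : Stage → Structure
    Below α l = ∃ λ β → β < α × l ∈ at β

    -- A valid literal holds at a limit stage without belonging to any earlier set; it is charged to
    -- `start`, where it holds as well.
    at-limit⁻ : ∀ {α} → IsLimit α → ∀ l → at α ⊨ l →
                start ⊨ l ⊎ ∃ λ β → β < α × at β ⊨ l
    at-limit⁻ {α} lim l x = go l (≈⇒⊑ (at α) (Below α) (at-limit α lim) x)
      where
      go : ∀ l → Below α ⊨ l → start ⊨ l ⊎ ∃ λ β → β < α × at β ⊨ l
      go (pos (⊤ₛ · _))     (holds x)             = inj₁ (holds x)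
      go (neg (⊥ₛ · _))     (holds x)             = inj₁ (holds x)
      go (pos (pred _ · _)) (holds (β , β<α , y)) = inj₂ (β , β<α , holds y)
      go (neg (pred _ · _)) (holds (β , β<α , y)) = inj₂ (β , β<α , holds y)

    at-limit⁺ : ∀ {α β} → IsLimit α → β < α → at β ⊑ at α
    at-limit⁺ {α} {β} lim β<α =
      ≈⇒⊒ (at α) (Below α) (at-limit α lim) ∘
      ⊆⇒⊑ (at β) (Below α) (λ y → β , β<α , y)

    at-mono-< : ∀ {α} → Acc _<_ α → ∀ {β} → β < α → at β ⊑ at α
    at-mono-< {α} (acc rec) {β} β<α with stageKind α
    ... | zeroˢ z = ⊥-elim (z β β<α)
    ... | limˢ lim = at-limit⁺ lim β<α
    ... | sucˢ γ s with compare β γ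
    ...   | tri< β<γ _ _ = refines-⊑ (at-successor α γ s) ∘ at-mono-< (rec (proj₁ s)) β<γ
    ...   | tri≈ _ refl _ = refines-⊑ (at-successor α γ s)
    ...   | tri> _ _ γ<β = ⊥-elim (proj₂ s β (γ<β , β<α))

    at⊑limit : ∀ α → at α ⊑ limit
    at⊑limit α with compare α last
    ... | tri< α<l _ _  = at-mono-< (wellFounded last) α<l
    ... | tri≈ _ refl _ = id
    ... | tri> _ _ l<α  = ⊥-elim (last-is-last α l<α)

    start⊑at : ∀ {α} → Acc _<_ α → start ⊑ at α
    start⊑at {α} (acc rec) with stageKind α
    ... | zeroˢ z = ≈⇒⊒ (at α) start (at-zero α z)
    ... | sucˢ γ s = refines-⊑ (at-successor α γ s) ∘ start⊑at (rec (proj₁ s))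
    ... | limˢ lim with em {P = ∃ λ β → β < α}
    ...   | yes (β , β<α) = at-limit⁺ lim β<α ∘ start⊑at (rec β<α)
    ...   | no none = ⊥-elim (proj₁ lim (λ β β<α → none (β , β<α)))

    start⊑limit : start ⊑ limit
    start⊑limit = start⊑at (wellFounded last)

    -- Transfinite induction for a property of single literals. Limit stages need no hypothesis,
    -- because each of their literals already holds at `start` or at an earlier stage.
    module _ (R : Pred Literal 0ℓ) (base : ∀ l → start ⊨ l → R l)
             (step : ∀ {α β} → Refines Δ (at β) (at α) →
                     (∀ l → at β ⊨ l → R l) → ∀ l → at α ⊨ l → R l)
      where

      invariant-at : ∀ {α} → Acc _<_ α → ∀ l → at α ⊨ l → R l
      invariant-at {α} (acc rec) l x with stageKind α
      ... | zeroˢ z = base l (≈⇒⊑ (at α) start (at-zero α z) x)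
      ... | sucˢ γ s = step (at-successor α γ s) (invariant-at (rec (proj₁ s))) l x
      ... | limˢ lim with at-limit⁻ lim l x
      ...   | inj₁ y = base l y
      ...   | inj₂ (β , β<α , y) = invariant-at (rec β<α) l y

      invariant : ∀ l → limit ⊨ l → R l
      invariant = invariant-at (wellFounded last)

    limit-atoms : ∀ l → limit ⊨ l → start ⊨ l ⊎ atom l ∈ Defined Δ
    limit-atoms = invariant _ (λ _ → inj₁)
      (λ r ih l x → [ ih l , inj₂ ]′ (established-atom (established r l x)))

  -- Refinement processes never contradict a justification.

  module Justified {Δ : RuleSet} {J : Graph} {L : Pred Literal 0ℓ}
                   (definition : IsDefinition Δ) (justification : IsJustification Δ J)
                   (justifies : Justifies Δ J L) where

    Reachable : Pred Literal 0ℓ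
    Reachable = ReachableFrom J L

    child-reachable : ∀ {l m} → l ∈ Reachable → m ∈ J l → m ∈ Reachable
    child-reachable (l₀ , x , path) e = l₀ , x , path ◅◅ (e ◅ ε)

    directly : ∀ l → atom l ∈ Defined Δ → l ∈ Reachable → IsDirectJustification Δ l (J l)
    directly l d x with justification l
    ... | inj₁ empty = ⊥-elim (empty _ (proj₂ (proj₁ justifies l d x)))
    ... | inj₂ dj    = dj

    Uncontradicted : Pred Literal 0ℓ
    Uncontradicted l = opposite l ∉ Reachable

    module _ {S S′ : Structure} (r : Refines Δ S S′) (ih : ∀ l → S ⊨ l → Uncontradicted l) where

      -- The body true in `S` is false in `J (neg a)`, so some literal of `S` is opposite to a child
      -- of `neg a`. That child is reachable, against the induction hypothesis on `S`.
      true-uncontradicted : S′ ⊨ pos a → neg a ∉ Reachable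
      true-uncontradicted {a} x reach with established r (pos a) x
      ... | kept s = ih (pos a) s reach
      ... | made-true b
        with body-clash Δ S (J (neg a)) definition b
               (proj₂ (proj₂ (directly (neg a) (body⇒Defined Δ S 𝐭 b) reach)))
      ...   | l , s , j = ih l s (child-reachable reach (proj₂ (clash-∈ s j)))

      module _ {l₀ : Literal} (l₀∈L : l₀ ∈ L) where

        -- The root `l₀` is fixed because well-foundedness concerns the paths below one literal of
        -- `L`.
        Contradicted : Pred Atom 0ℓ
        Contradicted a = Star J l₀ (pos a) × S′ ⊨ neg a

        -- The body is false only in `S′`, so the clashing child may itself be new in `S′` and the
        -- induction hypothesis does not exclude it. A negative child is excluded by
        -- `true-uncontradicted`; hence the child is positive and again contradicted.
        next : ∀ a → a ∈ Contradicted → ∃ λ b → b ∈ Contradicted × pos b ∈ J (pos a)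
        next a (path , x) with established r (neg a) x
        ... | kept s = ⊥-elim (ih (neg a) s (l₀ , l₀∈L , path))
        ... | made-false f
          with body-clash Δ (J (pos a)) S′ definition
                 (proj₂ (proj₂ (directly (pos a) (body⇒Defined Δ S′ 𝐟 f) (l₀ , l₀∈L , path)))) f
        ...   | pos b , j , s = let e = proj₁ (clash-∈ j s) in b , (path ◅◅ (e ◅ ε) , s) , e
        ...   | neg b , j , s = ⊥-elim (true-uncontradicted s
                  (child-reachable (l₀ , l₀∈L , path) (proj₁ (clash-∈ j s))))

        iterate : ∃ Contradicted → ℕ → ∃ Contradicted
        iterate c zero    = c
        iterate c (suc k) = let a , x = iterate c k in map id proj₁ (next a x)

        -- Iterating `next` yields an infinite path of positive literals below `l₀`, while
        -- well-foundedness makes its literal at index 0 negative.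
        not-contradicted : ∀ a → a ∉ Contradicted
        not-contradicted a x
          with proj₁ (proj₂ justifies) l₀ l₀∈L (λ k → pos (proj₁ (iterate (a , x) k)))
                 ( (λ k → l₀ , refl , proj₁ (proj₂ (iterate (a , x) k)))
                 , (λ k → let b , y = iterate (a , x) k in proj₂ (proj₂ (next b y))) ) 0
        ... | _ , ()

      uncontradicted-step : ∀ l → S′ ⊨ l → Uncontradicted l
      uncontradicted-step (pos a) x reach = true-uncontradicted x reach
      uncontradicted-step (neg a) x (l₀ , l₀∈L , path) = not-contradicted l₀∈L a (path , x)

    limit-uncontradicted : (p : RefinementProcess Δ start) →
      (∀ l → start ⊨ l → Uncontradicted l) →
      ∀ l → RefinementProcess.limit p ⊨ l → Uncontradicted l
    limit-uncontradicted p base = Process.invariant p Uncontradicted base uncontradicted-step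

  -- Processes of a subset of the rules stay within the two-valued limit.

  module Submodel {Δ Δ′ : RuleSet} {start : Structure}
    (definition : IsDefinition Δ)
    (sub : ∀ a S v → BodyOf a In Δ′ At S Is v → BodyOf a In Δ At S Is v)
    (p : RefinementProcess Δ start) (start-open : ∀ l → start ⊨ l → atom l ∉ Defined Δ)
    where

    private module P = Process p

    module _ (complete : ∀ l → atom l ∈ Defined Δ → P.limit ⊨ l ⊎ P.limit ⊨ opposite l)
             (consistent : ∀ l → P.limit ⊨ l → ¬ P.limit ⊨ opposite l) where

      module _ {S S′ : Structure} (r : Refines Δ′ S S′) (S⊑ : S ⊑ P.limit) where

        Compatible : Pred Literal 0ℓ
        Compatible l = ¬ S′ ⊨ opposite l

        true-defined : BodyOf a In Δ′ At S Is 𝐭 → a ∈ Defined Δ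
        true-defined b = body⇒Defined Δ S 𝐭 (sub _ S 𝐭 b)

        false-defined : BodyOf a In Δ′ At S′ Is 𝐟 → a ∈ Defined Δ
        false-defined b = body⇒Defined Δ S′ 𝐟 (sub _ S′ 𝐟 b)

        start-compatible : ∀ l → start ⊨ l → Compatible l
        start-compatible (pos a) x y with established r (neg a) y
        ... | kept s       = consistent (pos a) (P.start⊑limit x) (S⊑ s)
        ... | made-false b = start-open (pos a) x (false-defined b)
        start-compatible (neg a) x y with established r (pos a) y
        ... | kept s       = consistent (neg a) (P.start⊑limit x) (S⊑ s)
        ... | made-true b  = start-open (neg a) x (true-defined b)

        -- With `pos a` new at `α`, the bodies clash between `P.at β` and `S′`, against the
        -- induction hypothesis. With `neg a` new at `α`, they clash between `S` and `P.at α`, both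
        -- of which lie in the consistent limit.
        step-compatible : ∀ {α β} → Refines Δ (P.at β) (P.at α) →
                          (∀ l → P.at β ⊨ l → Compatible l) → ∀ l → P.at α ⊨ l → Compatible l
        step-compatible {α} {β} q ih (pos a) x y
          with established q (pos a) x | established r (neg a) y
        ... | kept s | _ = ih (pos a) s y
        ... | made-true _ | kept t = consistent (pos a) (P.at⊑limit α x) (S⊑ t)
        ... | made-true b | made-false c
          with body-clash Δ (P.at β) S′ definition b (sub a S′ 𝐟 c)
        ...   | m , s , t = ih m s t
        step-compatible {α} {β} q ih (neg a) x y
          with established q (neg a) x | established r (pos a) y
        ... | kept s | _ = ih (neg a) s y
        ... | made-false _ | kept t = consistent (neg a) (P.at⊑limit α x) (S⊑ t)
        ... | made-false b | made-true c
          with body-clash Δ S (P.at α) definition (sub a S 𝐭 c) b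
        ...   | m , s , t = consistent m (S⊑ s) (P.at⊑limit α t)

        limit-compatible : ∀ l → P.limit ⊨ l → Compatible l
        limit-compatible = P.invariant Compatible start-compatible step-compatible

        -- A new literal concerns an atom that the limit decides, and the opposite value is ruled
        -- out by `limit-compatible`.
        refinement⊑limit : ∀ l → S′ ⊨ l → P.limit ⊨ l
        refinement⊑limit l x with established r l x
        ... | kept s = S⊑ s
        ... | made-true {a} b =
          [ id , (λ n → ⊥-elim (limit-compatible (neg a) n x)) ]′ (complete (pos a) (true-defined b))
        ... | made-false {a} b =
          [ id , (λ n → ⊥-elim (limit-compatible (pos a) n x)) ]′ (complete (neg a) (false-defined b))

      sublimit⊑limit : ∀ {start′} (q : RefinementProcess Δ′ start′) → start′ ⊑ P.limit →
                       RefinementProcess.limit q ⊑ P.limit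
      sublimit⊑limit q base = Process.invariant q (P.limit ⊨_) (λ _ → base)
        (λ r ih → refinement⊑limit r (ih _)) _

  -- The open atoms and the well-founded model of the combined definition.

  module Extension (𝒯 : CanonicalTheory) {I-in : Structure} {Δg Δd : RuleSet} {J : Graph}
                   {I : Structure} (state : AcceptableState 𝒯 I-in Δg Δd J I)
                   (P-true : value I (CanonicalTheory.P-𝒯-atom 𝒯) is 𝐭)
                   (model : IsModel Δg (I ∣ atomsOf (voc Δg))) where

    open CanonicalTheory 𝒯 using (P-𝒯-atom; defined) renaming (Δ to Δ𝒯)
    open AcceptableState state

    private
      σ-g σ-gd σ-Δ : Pred Atom 0ℓ
      σ-g  = atomsOf (voc Δg)
      σ-gd = atomsOf (voc Δgd)
      σ-Δ  = atomsOf (voc Δ𝒯)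

    σ-g⊆σ-gd : σ-g ⊆ σ-gd
    σ-g⊆σ-gd = lookup-++⁺ˡ
      (λ r → _ ≡ (_ , pred (head r)) ⊎ _ ∈ symbols (body r)) Δg Δd

    module JL = Justified (proj₁ total-gd) justification justified

    I-consistent : I ⊨ pos a → ¬ I ⊨ neg a
    I-consistent {a} (holds p) (holds n) = proj₁ consistent-with a (p , n)

    I-true : ∀ l → I ⊨ l → literalValue I l is 𝐭
    I-true (pos a) p = literal-holds p , λ n → I-consistent p (holds n)
    I-true (neg a) n = literal-holds n , λ p → I-consistent (holds p) n

    reachable-not-false : ∀ l → l ∈ JL.Reachable → ¬ I ⊨ opposite l
    reachable-not-false (pos a) x n =
      proj₂ consistent-with (pos a) x ((λ p → I-consistent (holds p) n) , literal-holds n)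
    reachable-not-false (neg a) x p =
      proj₂ consistent-with (neg a) x ((λ n → I-consistent p (holds n)) , literal-holds p)

    Required : Pred Literal 0ℓ
    Required l = l ∈ JL.Reachable ⊎ I ⊨ l

    -- Two reachable literals do not conflict because `J` justifies `L`. The mixed cases use that no
    -- literal of the justification is false in `I`.
    required-consistent : ConsistentSet Required
    required-consistent a (inj₁ x , inj₁ y) = proj₂ (proj₂ justified) a (x , y)
    required-consistent a (inj₁ x , inj₂ y) = reachable-not-false (pos a) x y
    required-consistent a (inj₂ x , inj₁ y) = reachable-not-false (neg a) y x
    required-consistent a (inj₂ x , inj₂ y) = I-consistent x y

    valid-required : Valid l → l ∈ Required
    valid-required v = inj₂ (v I)

    module FromOpen (C : Structure) (C₂ : ∀ {σ} → TwoValued σ C) (I⊑C : I ⊑ C)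
                    (C-uncontradicted : ∀ l → C ⊨ l → JL.Uncontradicted l) where

      start-gd : Structure
      start-gd = C ∣ Open Δgd

      start-two-valued : TwoValuedStructureOf (Open Δgd) start-gd
      start-two-valued =
        ⊑⊒⇒≈ start-gd (start-gd ∣ Open Δgd)
          (∣-⊑ (Open Δgd) λ x y → ∣⁺ (Open Δgd) (∣⁺ (Open Δgd) x y) y) (∣⊑ start-gd (Open Δgd)) ,
        two-valued⁻ (two-valued-∣ C₂)

      module FromProcess {W : Structure} (W-wellFounded : IsWellFoundedModel Δgd start-gd W)
                         (W₂ : TwoValuedOn σ-gd W) where

        private
          process = proj₁ W-wellFounded
          module P = Process process

        W≈limit : W ≈ P.limit
        W≈limit = proj₂ (proj₂ W-wellFounded)

        limit₂ : TwoValued σ-gd P.limit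
        limit₂ = two-valued-resp (≈⇒⊑ W P.limit W≈limit)
          (≈⇒⊒ W P.limit W≈limit ∘ ∣⊑ P.limit σ-gd) (two-valued⁺ W₂)

        limit-atoms : P.limit ⊨ l → Valid l ⊎ atom l ∈ σ-gd
        limit-atoms {l} x =
          [ map₂ (proj₁ ∘ proj₂) ∘ ∣⁻ (Open Δgd) , inj₂ ∘ Defined⇒voc Δgd ]′ (P.limit-atoms l x)

        limit-consistent : ∀ l → P.limit ⊨ l → ¬ P.limit ⊨ opposite l
        limit-consistent l x = [ valid-no-clash , (λ v → consistent limit₂ l v x) ]′ (limit-atoms x)

        start-uncontradicted : ∀ l → start-gd ⊨ l → JL.Uncontradicted l
        start-uncontradicted l x = C-uncontradicted l (∣⊑ C (Open Δgd) x)

        -- The limit decides the atom, and it never contains the opposite of a reachable literal.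
        reachable⇒limit : ∀ l → atom l ∈ σ-gd → l ∈ JL.Reachable → P.limit ⊨ l
        reachable⇒limit l v x with complete limit₂ l v
        reachable⇒limit l v x | inj₁ y = y
        reachable⇒limit (pos a) v x | inj₂ y =
          ⊥-elim (JL.limit-uncontradicted process start-uncontradicted (neg a) y x)
        reachable⇒limit (neg a) v x | inj₂ y =
          ⊥-elim (JL.limit-uncontradicted process start-uncontradicted (pos a) y x)

        -- If `Δd` defines the atom, then `l` belongs to `L` and is reachable by the empty path.
        -- Otherwise the atom is open in `Δgd`, and the start already follows `I` there.
        I⇒limit : ∀ l → I ⊨ l → atom l ∈ σ-gd → atom l ∉ Defined Δg → P.limit ⊨ l
        I⇒limit l x v ¬g = [ defined-d , open-gd ]′ (decide (atom l ∈ Defined Δd))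
          where
          defined-d : atom l ∈ Defined Δd → P.limit ⊨ l
          defined-d d = reachable⇒limit l v (l , (I-true l x , d) , ε)

          open-gd : atom l ∉ Defined Δd → P.limit ⊨ l
          open-gd ¬d = P.start⊑limit
            (∣⁺ (Open Δgd) (I⊑C x) (v , [ ¬g , ¬d ]′ ∘ lookup-++⁻ (_defines atom l) Δg Δd))

        start-open : ∀ l → start-gd ⊨ l → atom l ∉ Defined Δgd
        start-open l x d =
          [ (λ v → valid-not-defined Δgd l v d) , (λ y → proj₂ (proj₂ y) d) ]′ (∣⁻ (Open Δgd) x)

        body-++ : ∀ a S v → BodyOf a In Δg At S Is v → BodyOf a In Δgd At S Is v
        body-++ a S v = lookup-++⁺ˡ (λ r → Σ (r defines a) λ d → bodyValue d S is v) Δg Δd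

        open Submodel {Δ′ = Δg} (proj₁ total-gd) body-++ process start-open

        -- The process of `Δg` that ends in `I` starts from open atoms of `Δg`, where `I⇒limit`
        -- applies; `sublimit⊑limit` carries the inclusion to its end.
        I∣voc-g⊑limit : I ∣ σ-g ⊑ P.limit
        I∣voc-g⊑limit x =
          let q , _ , eq = proj₂ model in
          sublimit⊑limit (λ l d → complete limit₂ l (Defined⇒voc Δgd d)) limit-consistent q
            (∣-⊑ (Open Δg) λ {l} y (v , ¬g) →
              I⇒limit l (∣⊑ I σ-g y) (σ-g⊆σ-gd {atom l} v) ¬g)
            -- The double restriction arises because `IsModel` restricts the already restricted
            -- structure again.
            (≈⇒⊑ ((I ∣ σ-g) ∣ σ-g) (RefinementProcess.limit q) eq
              (∣-⊑ σ-g (λ y v → ∣⁺ σ-g (∣⁺ σ-g y v) v) x))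

        -- The model over the joint vocabulary and its transfer to the theory.

        σ-rest : Pred Atom 0ℓ
        σ-rest a = a ∉ σ-gd × a ∈ σ-Δ

        -- Symbols of Δ need not occur in Δ_gd, not even P_𝒯; on them M follows I.
        M : Structure
        M = P.limit ∪ (C ∣ σ-rest)

        limit⊑M : P.limit ⊑ M
        limit⊑M = ⊆⇒⊑ P.limit M inj₁

        C∣rest⊑M : C ∣ σ-rest ⊑ M
        C∣rest⊑M = ⊆⇒⊑ (C ∣ σ-rest) M inj₂

        σ-M : Pred Atom 0ℓ
        σ-M = atomsOf (voc Δgd ∪ voc Δ𝒯)

        data Origin (l : Literal) : Set₁ where
          valid      : Valid l → Origin l
          from-limit : P.limit ⊨ l → atom l ∈ σ-gd → Origin l
          from-C     : C ⊨ l → atom l ∈ σ-rest → Origin l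

        origin : M ⊨ l → Origin l
        origin x =
          [ (λ y → [ valid , from-limit y ]′ (limit-atoms y))
          , (λ y → from-C (∣⊑ C σ-rest (proj₂ y)) (proj₂ (proj₁ y))) ]′
          (∪⁻ P.limit (C ∣ σ-rest) x)

        M-consistent : M ⊨ pos a → ¬ M ⊨ neg a
        M-consistent p n with origin p | origin n
        ... | valid v            | _                  = valid-no-clash v n
        ... | _                  | valid v            = valid-no-clash v p
        ... | from-limit x _     | from-limit y _     = limit-consistent _ x y
        ... | from-limit _ v     | from-C _ (¬v , _)  = ¬v v
        ... | from-C _ (¬v , _)  | from-limit _ v     = ¬v v
        ... | from-C x v         | from-C y _         = consistent (C₂ {σ-rest}) (pos _) v x y

        M₂ : TwoValued σ-M M
        M₂ .complete l v =
          [ in-limit l , (λ ¬v → in-C l (¬v , [ ⊥-elim ∘ ¬v , id ]′ v)) ]′ (decide (atom l ∈ σ-gd))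
          where
          in-limit : ∀ l → atom l ∈ σ-gd → M ⊨ l ⊎ M ⊨ opposite l
          in-limit l v = ⊎-map limit⊑M limit⊑M (complete limit₂ l v)

          in-C : ∀ l → atom l ∈ σ-rest → M ⊨ l ⊎ M ⊨ opposite l
          in-C l v = ⊎-map C∣rest⊑M C∣rest⊑M (complete (two-valued-∣ (C₂ {σ-rest})) l v)
        M₂ .consistent (pos a) _ p n = M-consistent p n
        M₂ .consistent (neg a) _ n p = M-consistent p n

        M-gd₂ : TwoValued σ-gd M
        M-gd₂ = two-valued-⊆ inj₁ M₂

        origin-∣ : Origin l → M ∣ σ-M ⊨ l
        origin-∣ (valid v)            = v _
        origin-∣ (from-limit x v)     = ∣⁺ σ-M (limit⊑M x) (inj₁ v)
        origin-∣ (from-C x v@(_ , w)) = ∣⁺ σ-M (C∣rest⊑M (∣⁺ σ-rest x v)) (inj₂ w)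

        limit≈limit∣ : P.limit ≈ P.limit ∣ σ-gd
        limit≈limit∣ = ⊑⊒⇒≈ P.limit (P.limit ∣ σ-gd)
          (λ x → [ (λ v → v _) , ∣⁺ σ-gd x ]′ (limit-atoms x)) (∣⊑ P.limit σ-gd)

        M-model-gd : IsModelOver (voc Δ𝒯) Δgd M
        M-model-gd =
          (⊑⊒⇒≈ M (M ∣ σ-M) (origin-∣ ∘ origin) (∣⊑ M σ-M) , two-valued⁻ M₂) ,
          two-valued⁻ M-gd₂ ,
          IsWellFoundedModel-resp-≈
            -- `C` and `M` are both two-valued on the open atoms, so one inclusion gives agreement.
            (two-valued-≈ (Open Δgd) id C₂ (two-valued-⊆ proj₁ M-gd₂) (limit⊑M ∘ P.start⊑limit))
            (≐-trans W≈limit (≐-trans limit≈limit∣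
              (two-valued-≈ σ-gd id limit₂ M-gd₂ (limit⊑M ∘ ∣⊑ P.limit σ-gd))))
            W-wellFounded

        -- The expansion `M″` given by strong equivalence contains `M` restricted to `σ-Δ`. Both are
        -- two-valued there, hence agree, and being a model of `Δ𝒯` depends only on `σ-Δ`.
        M-model : IsModel Δ𝒯 M
        M-model =
          let M″ , ((_ , two-valued″ , wellFounded″) , M″≥M) , _ = proj₁ equivalent M M-model-gd
              agree : ∀ τ → τ ⊆ σ-Δ → M ∣ τ ≈ M″ ∣ τ
              agree τ τ⊆ = two-valued-≈ τ τ⊆ M-Δ₂ (two-valued⁺ two-valued″)
                (≥ₚ⇒⊑ (M ∣ σ-Δ) M″ (λ {l} → M″≥M {l}))
          in  two-valued⁻ M-Δ₂ ,
              IsWellFoundedModel-resp-≈ (≐-sym (agree (Open Δ𝒯) proj₁)) (≐-sym (agree σ-Δ id))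
                wellFounded″
          where
          M-Δ₂ : TwoValued σ-Δ M
          M-Δ₂ = two-valued-⊆ inj₂ M₂

        -- The atom is defined by `Δg`, or is another atom of `σ-gd`, or lies outside `σ-gd`; these
        -- cases use agreement on `σ-g`, `I⇒limit` and the values of `C` respectively.
        M-satisfies-P : M ⊨ pos P-𝒯-atom
        M-satisfies-P =
          [ (λ v → limit⊑M ([ in-g , I⇒limit (pos P-𝒯-atom) I-P v ]′ (decide (P-𝒯-atom ∈ Defined Δg))))
          , (λ ¬v → C∣rest⊑M (∣⁺ σ-rest (I⊑C I-P) (¬v , Defined⇒voc Δ𝒯 defined))) ]′
          (decide (P-𝒯-atom ∈ σ-gd))
          where
          I-P : I ⊨ pos P-𝒯-atom
          I-P = holds (proj₁ P-true)

          in-g : P-𝒯-atom ∈ Defined Δg → P.limit ⊨ pos P-𝒯-atom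
          in-g g = I∣voc-g⊑limit (∣⁺ σ-g I-P (Defined⇒voc Δg g))

        extension : ∃ λ M → IsTheoryModel 𝒯 M × (M ≥ₚ I ∣ σ-g)
        extension = M , (M-model , literal-holds M-satisfies-P , M-consistent M-satisfies-P ∘ holds) ,
                    (λ {l} → ⊑⇒≥ₚ (I ∣ σ-g) M (limit⊑M ∘ I∣voc-g⊑limit) {l})

      extension : ∃ λ M → IsTheoryModel 𝒯 M × (M ≥ₚ I ∣ σ-g)
      extension =
        let W , W-wellFounded , W₂ = proj₂ total-gd start-gd start-two-valued
        in  FromProcess.extension W-wellFounded W₂

    extension : ∃ λ M → IsTheoryModel 𝒯 M × (M ≥ₚ I ∣ σ-g)
    -- `Required` contains the literals of `I` and all reachable ones, so its completion expands `I`
    -- and contradicts nothing reachable.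
    extension = FromOpen.extension (completion Required)
      (two-valued⁺ completion-two-valued)
      (λ x → completion-⊨⁺ required-consistent valid-required _ (inj₂ x))
      (λ l x y → completion-⊨⁻ required-consistent valid-required l x (inj₁ y))

theorem3p5 : (∀ {ℓ} → ExcludedMiddle ℓ) →
    (Sg : Signature) → let open Logic Sg in
    (𝒯 : CanonicalTheory) (I-in : Structure)
    (Δg Δd : RuleSet) (J : Graph) (I : Structure) →
    AcceptableState 𝒯 I-in Δg Δd J I →
    value I (CanonicalTheory.P-𝒯-atom 𝒯) is 𝐭 →
    IsModel Δg (I ∣ atomsOf (voc Δg)) →
    ∃ λ M → IsTheoryModel 𝒯 M × (M ≥ₚ I ∣ atomsOf (voc Δg))
theorem3p5 em Sg 𝒯 I-in Δg Δd J I state P-true model = extension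
  where open WellFoundedModels em Sg
        open Extension 𝒯 state P-true model
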